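{- Let $r$ and $n$ be integers such that $1 \le r \le n$ and $n \equiv 0 \pmod r$. For $k \ge 2$, if $F_1, F_2, \ldots, F_k$ are graphs on a common set of $n$ vertices, each of which consists of the vertex-disjoint union of $n/r$ copies of $K_r$, then \[ \gamma_{\rm sd}(F_1,F_2,\ldots,F_k) \le \left( 1 - \left( \frac{r-1}{r} \right)^{k-1} \right) n. \]
   Context: All graphs are finite and simple. Given graphs $F_1,\ldots,F_k$ (called factors; not necessarily edge-disjoint) with common vertex set $V$, a set $S \subseteq V$ is a simultaneous dominating set if for every $i$, $1 \le i \le k$, every vertex not in $S$ is adjacent in $F_i$ to some vertex of $S$. The simultaneous domination number $\gamma_{\rm sd}(F_1,\ldots,F_k)$ is the minimum cardinality of a simultaneous dominating set. -}

module Defs where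

open import Data.Fin.Base using (Fin)
open import Data.Fin.Properties using (all?; any?; _≟_)
open import Data.Fin.Subset using (Subset; _∈_; _∉_; ∣_∣; ⊤)
open import Data.Fin.Subset.Properties using (_∈?_; ∈⊤; anySubset?)
open import Data.Nat.Base using (ℕ; zero; suc; _≤_; z≤n; s≤s)
import Data.Nat.Properties as ℕ
open import Data.Product using (∃; _×_; _,_; proj₁; map)
open import Data.Rational.Base using (+-*-rawSemiring)
open import Function.Base using (_∘_)
open import Function.Bundles using (_⇔_; _⤖_; module Bijection)
open import Level using (0ℓ)
open import Relation.Binary.Core using (Rel)
open import Relation.Binary.Definitions using (Decidable; Irreflexive; Symmetric)
open import Relation.Binary.PropositionalEquality using (_≡_; _≢_; refl; sym)
open import Relation.Nullary using (contradiction; yes; no)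
open import Relation.Nullary.Decidable using (_×-dec_; _→-dec_; ¬?)
import Relation.Unary as U

open import Algebra.Definitions.RawSemiring +-*-rawSemiring public using (_^_)

-- Decidability of adjacency is automatic classically; it makes the
-- minimum in γsd computable.
record Graph (V : Set) : Set₁ where
  field
    Adj         : Rel V 0ℓ
    Adj-sym     : Symmetric Adj
    Adj-irrefl  : Irreflexive _≡_ Adj
    Adj?        : Decidable Adj

open Graph public

K : (r : ℕ) → Graph (Fin r)
K r = record
  { Adj        = _≢_
  ; Adj-sym    = λ u≢v v≡u → u≢v (sym v≡u)
  ; Adj-irrefl = λ u≡v u≢v → u≢v u≡v
  ; Adj?       = λ u v → ¬? (u ≟ v)
  }

copies : {V : Set} (m : ℕ) → Graph V → Graph (Fin m × V)
copies m G = record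
  { Adj        = λ { (i , u) (j , v) → i ≡ j × Adj G u v }
  ; Adj-sym    = map sym (Adj-sym G)
  ; Adj-irrefl = λ { refl (_ , uv) → Adj-irrefl G refl uv }
  ; Adj?       = λ { (i , u) (j , v) → (i ≟ j) ×-dec Adj? G u v }
  }

infix 4 _≅_

_≅_ : {V W : Set} → Graph V → Graph W → Set
_≅_ {V} {W} G H =
  ∃ λ (f : V ⤖ W) → ∀ u v → Adj G u v ⇔ Adj H (Bijection.to f u) (Bijection.to f v)

SimultaneousDominating : {k n : ℕ} → (Fin k → Graph (Fin n)) → Subset n → Set
SimultaneousDominating F S =
  ∀ i v → v ∉ S → ∃ λ u → u ∈ S × Adj (F i) v u

simultaneousDominating? : {k n : ℕ} (F : Fin k → Graph (Fin n)) →
  U.Decidable (SimultaneousDominating F)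
simultaneousDominating? F S =
  all? λ i → all? λ v →
    ¬? (v ∈? S) →-dec any? (λ u → (u ∈? S) ×-dec Adj? (F i) v u)

⊤-simultaneousDominating : {k n : ℕ} (F : Fin k → Graph (Fin n)) →
  SimultaneousDominating F ⊤
⊤-simultaneousDominating F i v v∉⊤ = contradiction ∈⊤ v∉⊤

IsLeast : (ℕ → Set) → ℕ → Set
IsLeast P m = P m × (∀ j → P j → m ≤ j)

least : {P : ℕ → Set} → U.Decidable P → ∀ b → P b → ∃ (IsLeast P)
least P? zero    p = zero , p , λ _ _ → z≤n
least P? (suc b) p with P? zero
... | yes p₀ = zero , p₀ , λ _ _ → z≤n
... | no ¬p₀ with least (P? ∘ suc) b p
...   | m , pₘ , m≤ = suc m , pₘ , λ
        { zero    p₀ → contradiction p₀ ¬p₀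
        ; (suc j) pⱼ → s≤s (m≤ j pⱼ)
        }

HasSimultaneousDominatingSetOfSize : {k n : ℕ} → (Fin k → Graph (Fin n)) → ℕ → Set
HasSimultaneousDominatingSetOfSize F m =
  ∃ λ S → SimultaneousDominating F S × ∣ S ∣ ≡ m

minimumSize : {k n : ℕ} (F : Fin k → Graph (Fin n)) →
  ∃ (IsLeast (HasSimultaneousDominatingSetOfSize F))
minimumSize {n = n} F =
  least
    (λ m → anySubset? λ S → simultaneousDominating? F S ×-dec (∣ S ∣ ℕ.≟ m))
    ∣ ⊤ {n = n} ∣
    (⊤ , ⊤-simultaneousDominating F , refl)

γsd : {k n : ℕ} → (Fin k → Graph (Fin n)) → ℕ
γsd F = proj₁ (minimumSize F)

{-# OPTIONS --safe #-}

-- A set dominates every factor as soon as it meets every block (clique) of every factor.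
-- Two partitions into blocks of size r have a common transversal (regular bipartite
-- multigraphs have perfect matchings), so two factors need only n / r vertices. Given a
-- set S and one more factor, the blocks missing S lie in the complement of S, so there are
-- at most (n - ∣ S ∣) / r of them; adding one vertex of each leaves at least a
-- fraction (r - 1) / r of the complement.
module Submission where

open import Defs
open import Data.Fin.Base using (Fin)
open import Data.Integer.Base as ℤ using (+_)
open import Data.Nat.Base as ℕ using (ℕ; NonZero)
open import Data.Rational.Base using (_≤_; _-_; _*_; _/_; 1ℚ)
open import Relation.Binary.PropositionalEquality using (_≡_)

open import Algebra.Bundles using (CommutativeRing)
open import Data.Bool.Base using (Bool; true; false; if_then_else_)
open import Data.Fin.Base using (zero; suc; quotient; _↑ˡ_; _↑ʳ_)
open import Data.Fin.Permutation using (Permutation; _⟨$⟩ʳ_)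
open import Data.Fin.Properties using (all?; any?; *↔×; splitAt-↑ˡ; splitAt-↑ʳ; remQuot-combine)
import Data.Fin.Properties as Fin
open import Data.Fin.Subset
  using (Subset; inside; outside; _∈_; _∉_; _⊆_; ∣_∣; ⊤; ⊥; ∁; ⁅_⁆; _∪_; _∩_)
  renaming (_-_ to _∖_)
open import Data.Fin.Subset.Properties
import Data.Integer.Properties as ℤ
open import Data.Nat.Base using (_<_; s≤s)
open import Data.Nat.Induction using (<-wellFounded)
import Data.Nat.Properties as ℕ
import Data.Nat.Solver as ℕ
open import Data.Product using (∃; ∃₂; _×_; _,_; proj₁; proj₂)
open import Data.Rational.Base as ℚ using (ℚ; fromℚᵘ; toℚᵘ)
import Data.Rational.Properties as ℚ
import Data.Rational.Solver as ℚ
open import Data.Rational.Unnormalised.Base as ℚᵘ using (mkℚᵘ; *≡*)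
import Data.Rational.Unnormalised.Properties as ℚᵘ
open import Data.Sum as Sum using (_⊎_; inj₁; inj₂)
open import Data.Vec.Base using ([]; _∷_; here; there; lookup; tabulate)
open import Data.Vec.Properties using (lookup∘tabulate; tabulate∘lookup; lookup⇒[]=; []=⇒lookup)
open import Function.Base using (_∘_)
open import Function.Bundles using (module Bijection; module Equivalence)
open import Function.Construct.Composition using (_↔-∘_)
open import Function.Construct.Symmetry using (↔-sym)
open import Function.Properties.Bijection using (⤖⇒↔)
open import Induction.WellFounded using (Acc; acc)
open import Relation.Binary.PropositionalEquality
  using (_≢_; refl; sym; trans; cong; cong₂; subst; module ≡-Reasoning)
open import Relation.Nullary using (¬_; Dec; yes; no; contradiction)
open import Relation.Nullary.Decidable using (_×-dec_; _⊎-dec_; _→-dec_; ¬?)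

open import Algebra.Properties.CommutativeMonoid.Sum ℕ.+-0-commutativeMonoid
  using (sum; sum-cong-≗; sum-permute)

private variable
  m n r : ℕ

-- Cardinalities, images and preimages of finite subsets.

∣p∪q∣+∣p∩q∣≡∣p∣+∣q∣ : (p q : Subset n) → ∣ p ∪ q ∣ ℕ.+ ∣ p ∩ q ∣ ≡ ∣ p ∣ ℕ.+ ∣ q ∣
∣p∪q∣+∣p∩q∣≡∣p∣+∣q∣ []            []            = refl
∣p∪q∣+∣p∩q∣≡∣p∣+∣q∣ (outside ∷ p) (outside ∷ q) = ∣p∪q∣+∣p∩q∣≡∣p∣+∣q∣ p q
∣p∪q∣+∣p∩q∣≡∣p∣+∣q∣ (inside  ∷ p) (outside ∷ q) = cong ℕ.suc (∣p∪q∣+∣p∩q∣≡∣p∣+∣q∣ p q)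
∣p∪q∣+∣p∩q∣≡∣p∣+∣q∣ (outside ∷ p) (inside  ∷ q) =
  trans (cong ℕ.suc (∣p∪q∣+∣p∩q∣≡∣p∣+∣q∣ p q)) (sym (ℕ.+-suc ∣ p ∣ ∣ q ∣))
∣p∪q∣+∣p∩q∣≡∣p∣+∣q∣ (inside  ∷ p) (inside  ∷ q) = cong ℕ.suc
  (trans (ℕ.+-suc _ _)
    (trans (cong ℕ.suc (∣p∪q∣+∣p∩q∣≡∣p∣+∣q∣ p q)) (sym (ℕ.+-suc ∣ p ∣ ∣ q ∣))))

∣p∪q∣≤∣p∣+∣q∣ : (p q : Subset n) → ∣ p ∪ q ∣ ℕ.≤ ∣ p ∣ ℕ.+ ∣ q ∣
∣p∪q∣≤∣p∣+∣q∣ p q = ℕ.≤-trans (ℕ.m≤m+n _ _) (ℕ.≤-reflexive (∣p∪q∣+∣p∩q∣≡∣p∣+∣q∣ p q))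

∣∁p∣+∣p∣≡n : (p : Subset n) → ∣ ∁ p ∣ ℕ.+ ∣ p ∣ ≡ n
∣∁p∣+∣p∣≡n p = trans (cong (ℕ._+ ∣ p ∣) (∣∁p∣≡n∸∣p∣ p)) (ℕ.m∸n+n≡m (∣p∣≤n p))

∣∁⁅x⁆∣<n : (x : Fin n) → ∣ ∁ ⁅ x ⁆ ∣ < n
∣∁⁅x⁆∣<n {n} x = subst (∣ ∁ ⁅ x ⁆ ∣ <_) (∣∁p∣+∣p∣≡n ⁅ x ⁆)
  (subst (λ k → ∣ ∁ ⁅ x ⁆ ∣ < ∣ ∁ ⁅ x ⁆ ∣ ℕ.+ k) (sym (∣⁅x⁆∣≡1 x)) (ℕ.m<m+n _ (s≤s ℕ.z≤n)))

image : (Fin m → Fin n) → Subset m → Subset n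
image f []            = ⊥
image f (outside ∷ p) = image (f ∘ suc) p
image f (inside  ∷ p) = ⁅ f zero ⁆ ∪ image (f ∘ suc) p

∣image∣≤ : (f : Fin m → Fin n) (p : Subset m) → ∣ image f p ∣ ℕ.≤ ∣ p ∣
∣image∣≤ {n = n} f [] = ℕ.≤-reflexive (∣⊥∣≡0 n)
∣image∣≤ f (outside ∷ p) = ∣image∣≤ (f ∘ suc) p
∣image∣≤ f (inside  ∷ p) = ℕ.≤-trans (∣p∪q∣≤∣p∣+∣q∣ ⁅ f zero ⁆ (image (f ∘ suc) p))
  (ℕ.+-mono-≤ (ℕ.≤-reflexive (∣⁅x⁆∣≡1 (f zero))) (∣image∣≤ (f ∘ suc) p))

∈-image⁺ : (f : Fin m → Fin n) {p : Subset m} {x : Fin m} → x ∈ p → f x ∈ image f p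
∈-image⁺ f {inside  ∷ p} {zero}  _ = x∈p∪q⁺ (inj₁ (x∈⁅x⁆ (f zero)))
∈-image⁺ f {inside  ∷ p} {suc x} (there x∈p) =
  x∈p∪q⁺ (inj₂ (∈-image⁺ (f ∘ suc) x∈p))
∈-image⁺ f {outside ∷ p} {suc x} (there x∈p) = ∈-image⁺ (f ∘ suc) x∈p

∈-image⁻ : (f : Fin m → Fin n) (p : Subset m) {y : Fin n} →
  y ∈ image f p → ∃ λ x → x ∈ p × f x ≡ y
∈-image⁻ f []            y∈ = contradiction y∈ ∉⊥
∈-image⁻ f (outside ∷ p) y∈ with x , x∈p , fx≡y ← ∈-image⁻ (f ∘ suc) p y∈ =
  suc x , there x∈p , fx≡y
∈-image⁻ f (inside ∷ p) y∈ with x∈p∪q⁻ ⁅ f zero ⁆ (image (f ∘ suc) p) y∈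
... | inj₁ y∈⁅f0⁆ = zero , here , sym (x∈⁅y⁆⇒x≡y (f zero) y∈⁅f0⁆)
... | inj₂ y∈rest with x , x∈p , fx≡y ← ∈-image⁻ (f ∘ suc) p y∈rest =
  suc x , there x∈p , fx≡y

preimage : (Fin n → Fin m) → Subset m → Subset n
preimage f p = tabulate (lookup p ∘ f)

∈-preimage⁺ : (f : Fin n → Fin m) {p : Subset m} {x : Fin n} → f x ∈ p → x ∈ preimage f p
∈-preimage⁺ f {p} {x} fx∈p =
  lookup⇒[]= x _ (trans (lookup∘tabulate (lookup p ∘ f) x) ([]=⇒lookup fx∈p))

∈-preimage⁻ : (f : Fin n → Fin m) {p : Subset m} {x : Fin n} → x ∈ preimage f p → f x ∈ p
∈-preimage⁻ f {p} {x} x∈ =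
  lookup⇒[]= (f x) p (trans (sym (lookup∘tabulate (lookup p ∘ f) x)) ([]=⇒lookup x∈))

-- Partitions into blocks, encoded as maps from points to block indices.

Hits : (Fin n → Fin m) → Subset n → Set
Hits p S = ∀ i → ∃ λ e → e ∈ S × p e ≡ i

hits-mono : {p : Fin n → Fin m} {S T : Subset n} → S ⊆ T → Hits p S → Hits p T
hits-mono S⊆T hits i = let e , e∈S , pe≡i = hits i in e , S⊆T e∈S , pe≡i

-- Quantifying over sets of blocks gives the form that double counting uses directly. Singletons `A`
-- say that each block has `r` points.
Equitable : ℕ → (Fin n → Fin m) → Set
Equitable r p = ∀ A → ∣ preimage p A ∣ ≡ r ℕ.* ∣ A ∣

r*m≤n : {p : Fin n → Fin m} → Equitable r p → r ℕ.* m ℕ.≤ n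
r*m≤n {m = m} {r = r} {p} eq =
  subst (ℕ._≤ _) (trans (eq ⊤) (cong (r ℕ.*_) (∣⊤∣≡n m))) (∣p∣≤n (preimage p ⊤))

-- Perfect matchings in regular bipartite multigraphs, by vertex covers.

-- The points of Fin n are the edges of a bipartite multigraph, the point e joining the
-- vertex p e on one side to the vertex q e on the other; covers are vertex covers.
module _ (p q : Fin n → Fin m) where

  Cover : Subset n → Subset m → Subset m → Set
  Cover T A B = ∀ e → e ∈ T → p e ∈ A ⊎ q e ∈ B

  -- By König's theorem, a cover by fewer than `m` vertices is exactly the obstruction to a perfect
  -- matching inside `T`.
  SmallCover : Subset n → Set
  SmallCover T = ∃₂ λ A B → Cover T A B × ∣ A ∣ ℕ.+ ∣ B ∣ < m

  smallCover? : ∀ T → Dec (SmallCover T)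
  smallCover? T = anySubset? λ A → anySubset? λ B →
    all? (λ e → (e ∈? T) →-dec ((p e ∈? A) ⊎-dec (q e ∈? B)))
      ×-dec (∣ A ∣ ℕ.+ ∣ B ∣ ℕ.<? m)

  cover-insert : ∀ {T A B e} → Cover (T ∖ e) A B → p e ∈ A ⊎ q e ∈ B → Cover T A B
  cover-insert {e = e} cov e-cov g g∈T with g Fin.≟ e
  ... | yes refl = e-cov
  ... | no g≢e   = cov g (x∈p∧x≢y⇒x∈p-y g∈T g≢e)

  -- Uncrossing: when neither cover contains the common endpoint p e, both
  -- (A ∩ A′ , B ∪ B′) and (A ∪ A′ ∪ ⁅ p e ⁆ , B ∩ B′) cover T, and by modularity their sizes
  -- add up to at most 2 (m - 1) + 1.
  smallCover-merge : ∀ {T e f} → e ∈ T → f ∈ T → e ≢ f → p e ≡ p f →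
    SmallCover (T ∖ e) → SmallCover (T ∖ f) → SmallCover T
  smallCover-merge {T} {e} {f} e∈T f∈T e≢f pe≡pf (A , B , cov , <m) (A′ , B′ , cov′ , <m′)
    with p e ∈? A | p f ∈? A′
  ... | yes pe∈A | _ = A , B , cover-insert cov (inj₁ pe∈A) , <m
  ... | no _ | yes pf∈A′ = A′ , B′ , cover-insert cov′ (inj₁ pf∈A′) , <m′
  ... | no pe∉A | no pf∉A′ = smaller
    where
    C₁ C₂ D₁ D₂ : Subset m
    C₁ = A ∩ A′
    D₁ = B ∪ B′
    -- Adding `p e` covers both `e` and `f`, each of which is known to be covered by only one of the
    -- two given covers.
    C₂ = (A ∪ A′) ∪ ⁅ p e ⁆
    D₂ = B ∩ B′

    -- The edge `e` survives the deletion of `f`, and its end `p e` lies outside `A′`, so the second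
    -- cover must catch it at `q e`. The argument for `f` is symmetric.
    qe∈B′ : q e ∈ B′
    qe∈B′ with cov′ e (x∈p∧x≢y⇒x∈p-y e∈T e≢f)
    ... | inj₁ pe∈A′ = contradiction (subst (_∈ A′) pe≡pf pe∈A′) pf∉A′
    ... | inj₂ qe∈B′ = qe∈B′

    qf∈B : q f ∈ B
    qf∈B with cov f (x∈p∧x≢y⇒x∈p-y f∈T (e≢f ∘ sym))
    ... | inj₁ pf∈A = contradiction (subst (_∈ A) (sym pe≡pf) pf∈A) pe∉A
    ... | inj₂ qf∈B = qf∈B

    both : ∀ g → g ∈ T → g ≢ e → g ≢ f →
      (p g ∈ A ⊎ q g ∈ B) × (p g ∈ A′ ⊎ q g ∈ B′)
    both g g∈T g≢e g≢f = cov g (x∈p∧x≢y⇒x∈p-y g∈T g≢e) , cov′ g (x∈p∧x≢y⇒x∈p-y g∈T g≢f)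

    cov₁ : Cover T C₁ D₁
    cov₁ g g∈T with g Fin.≟ e | g Fin.≟ f
    ... | yes refl | _        = inj₂ (x∈p∪q⁺ (inj₂ qe∈B′))
    ... | no _     | yes refl = inj₂ (x∈p∪q⁺ (inj₁ qf∈B))
    ... | no g≢e   | no g≢f with both g g∈T g≢e g≢f
    ...   | inj₁ a , inj₁ a′ = inj₁ (x∈p∩q⁺ (a , a′))
    ...   | inj₂ b , _       = inj₂ (x∈p∪q⁺ (inj₁ b))
    ...   | inj₁ _ , inj₂ b′ = inj₂ (x∈p∪q⁺ (inj₂ b′))

    cov₂ : Cover T C₂ D₂
    cov₂ g g∈T with g Fin.≟ e | g Fin.≟ f
    ... | yes refl | _        = inj₁ (x∈p∪q⁺ (inj₂ (x∈⁅x⁆ (p e))))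
    ... | no _     | yes refl =
      inj₁ (x∈p∪q⁺ (inj₂ (subst (_∈ ⁅ p e ⁆) pe≡pf (x∈⁅x⁆ (p e)))))
    ... | no g≢e   | no g≢f with both g g∈T g≢e g≢f
    ...   | inj₂ b , inj₂ b′ = inj₂ (x∈p∩q⁺ (b , b′))
    ...   | inj₁ a , _       = inj₁ (x∈p∪q⁺ (inj₁ (x∈p∪q⁺ (inj₁ a))))
    ...   | inj₂ _ , inj₁ a′ = inj₁ (x∈p∪q⁺ (inj₁ (x∈p∪q⁺ (inj₂ a′))))

    ∣C₂∣≤ : ∣ C₂ ∣ ℕ.≤ ∣ A ∪ A′ ∣ ℕ.+ 1
    ∣C₂∣≤ = subst (λ k → ∣ C₂ ∣ ℕ.≤ ∣ A ∪ A′ ∣ ℕ.+ k) (∣⁅x⁆∣≡1 (p e))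
      (∣p∪q∣≤∣p∣+∣q∣ (A ∪ A′) ⁅ p e ⁆)

    sizes : (∣ C₁ ∣ ℕ.+ ∣ D₁ ∣) ℕ.+ (∣ C₂ ∣ ℕ.+ ∣ D₂ ∣) < m ℕ.+ m
    sizes = begin-strict
      (∣ C₁ ∣ ℕ.+ ∣ D₁ ∣) ℕ.+ (∣ C₂ ∣ ℕ.+ ∣ D₂ ∣)
        ≤⟨ ℕ.+-monoʳ-≤ (∣ C₁ ∣ ℕ.+ ∣ D₁ ∣) (ℕ.+-monoˡ-≤ ∣ D₂ ∣ ∣C₂∣≤) ⟩
      (∣ C₁ ∣ ℕ.+ ∣ D₁ ∣) ℕ.+ ((∣ A ∪ A′ ∣ ℕ.+ 1) ℕ.+ ∣ D₂ ∣)
        ≡⟨ solve 4 (λ c d u v → (c :+ d) :+ ((u :+ con 1) :+ v)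
                     := con 1 :+ ((u :+ c) :+ (d :+ v))) refl
             (∣ C₁ ∣) (∣ D₁ ∣) (∣ A ∪ A′ ∣) (∣ D₂ ∣) ⟩
      1 ℕ.+ ((∣ A ∪ A′ ∣ ℕ.+ ∣ C₁ ∣) ℕ.+ (∣ D₁ ∣ ℕ.+ ∣ D₂ ∣))
        ≡⟨ cong ℕ.suc (cong₂ ℕ._+_ (∣p∪q∣+∣p∩q∣≡∣p∣+∣q∣ A A′) (∣p∪q∣+∣p∩q∣≡∣p∣+∣q∣ B B′)) ⟩
      1 ℕ.+ ((∣ A ∣ ℕ.+ ∣ A′ ∣) ℕ.+ (∣ B ∣ ℕ.+ ∣ B′ ∣))
        ≡⟨ solve 4 (λ a a′ b b′ → con 1 :+ ((a :+ a′) :+ (b :+ b′))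
                     := (con 1 :+ (a :+ b)) :+ (a′ :+ b′)) refl
             (∣ A ∣) (∣ A′ ∣) (∣ B ∣) (∣ B′ ∣) ⟩
      ℕ.suc (∣ A ∣ ℕ.+ ∣ B ∣) ℕ.+ (∣ A′ ∣ ℕ.+ ∣ B′ ∣)
        -- Read as a bound on the successor, `<m` absorbs the one added vertex, while `<m′` keeps
        -- the sum strict.
        <⟨ ℕ.+-mono-≤-< <m <m′ ⟩
      m ℕ.+ m ∎
      where
      open ℕ.≤-Reasoning
      open ℕ.+-*-Solver

    smaller : SmallCover T
    smaller with ∣ C₁ ∣ ℕ.+ ∣ D₁ ∣ ℕ.<? m | ∣ C₂ ∣ ℕ.+ ∣ D₂ ∣ ℕ.<? m
    ... | yes <m₁ | _       = C₁ , D₁ , cov₁ , <m₁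
    ... | no _    | yes <m₂ = C₂ , D₂ , cov₂ , <m₂
    ... | no ≮m₁  | no ≮m₂  =
      contradiction sizes (ℕ.≤⇒≯ (ℕ.+-mono-≤ (ℕ.≮⇒≥ ≮m₁) (ℕ.≮⇒≥ ≮m₂)))

  InjectiveOn : Subset n → Set
  InjectiveOn T = ∀ {e f} → e ∈ T → f ∈ T → p e ≡ p f → e ≡ f

  -- Edges are deleted until no two share their `p`-end. Of two that do, one can always go without
  -- creating a small cover, since otherwise `smallCover-merge` would yield a small cover of `T`.
  prune : ∀ T → Acc _<_ ∣ T ∣ → ¬ SmallCover T → ∃ λ T′ → ¬ SmallCover T′ × InjectiveOn T′
  prune T (acc rec) ¬small
    with any? (λ e → any? (λ f →
      (e ∈? T) ×-dec (f ∈? T) ×-dec ¬? (e Fin.≟ f) ×-dec (p e Fin.≟ p f)))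
  ... | no ¬clash = T , ¬small , injective
    where
    injective : InjectiveOn T
    injective {e} {f} e∈T f∈T pe≡pf with e Fin.≟ f
    ... | yes e≡f = e≡f
    ... | no e≢f  = contradiction (e , f , e∈T , f∈T , e≢f , pe≡pf) ¬clash
  ... | yes (e , f , e∈T , f∈T , e≢f , pe≡pf)
    with smallCover? (T ∖ e) | smallCover? (T ∖ f)
  ...   | no ¬small₁ | _          = prune (T ∖ e) (rec (x∈p⇒∣p-x∣<∣p∣ e∈T)) ¬small₁
  ...   | yes _      | no ¬small₂ = prune (T ∖ f) (rec (x∈p⇒∣p-x∣<∣p∣ f∈T)) ¬small₂
  ...   | yes small₁ | yes small₂ =
    contradiction (smallCover-merge e∈T f∈T e≢f pe≡pf small₁ small₂) ¬small

  -- If no edge of `T` ended at `i`, the other `m - 1` vertices on the `p` side would cover `T`.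
  ¬smallCover⇒hitsˡ : ∀ {T} → ¬ SmallCover T → Hits p T
  ¬smallCover⇒hitsˡ {T} ¬small i with any? (λ e → (e ∈? T) ×-dec (p e Fin.≟ i))
  ... | yes hit = hit
  ... | no ¬hit = contradiction (∁ ⁅ i ⁆ , ⊥ , cov , <m) ¬small
    where
    cov : Cover T (∁ ⁅ i ⁆) ⊥
    cov e e∈T = inj₁ (x∉p⇒x∈∁p (x≢y⇒x∉⁅y⁆ (λ pe≡i → ¬hit (e , e∈T , pe≡i))))

    <m : ∣ ∁ ⁅ i ⁆ ∣ ℕ.+ ∣ ⊥ {n = m} ∣ < m
    <m rewrite ∣⊥∣≡0 m | ℕ.+-identityʳ ∣ ∁ ⁅ i ⁆ ∣ = ∣∁⁅x⁆∣<n i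

  -- Each vertex lies on `r` edges, so fewer than `m` vertices cover fewer than `r m` edges, and
  -- there are at least `r m` edges in all.
  equitable⇒¬smallCover : .{{_ : NonZero r}} → Equitable r p → Equitable r q → ¬ SmallCover ⊤
  equitable⇒¬smallCover {r} eqp eqq (A , B , cov , <m) = ℕ.<-irrefl refl (begin-strict
    n                                      ≡⟨ ∣⊤∣≡n n ⟨
    ∣ ⊤ {n = n} ∣                          ≤⟨ p⊆q⇒∣p∣≤∣q∣ ⊤⊆ ⟩
    ∣ preimage p A ∪ preimage q B ∣        ≤⟨ ∣p∪q∣≤∣p∣+∣q∣ (preimage p A) (preimage q B) ⟩
    ∣ preimage p A ∣ ℕ.+ ∣ preimage q B ∣  ≡⟨ cong₂ ℕ._+_ (eqp A) (eqq B) ⟩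
    r ℕ.* ∣ A ∣ ℕ.+ r ℕ.* ∣ B ∣            ≡⟨ ℕ.*-distribˡ-+ r ∣ A ∣ ∣ B ∣ ⟨
    r ℕ.* (∣ A ∣ ℕ.+ ∣ B ∣)                <⟨ ℕ.*-monoʳ-< r <m ⟩
    r ℕ.* m                                ≤⟨ r*m≤n {r = r} {p} eqp ⟩
    n                                      ∎)
    where
    open ℕ.≤-Reasoning

    ⊤⊆ : ⊤ ⊆ preimage p A ∪ preimage q B
    ⊤⊆ {e} e∈⊤ with cov e e∈⊤
    ... | inj₁ pe∈A = x∈p∪q⁺ (inj₁ (∈-preimage⁺ p pe∈A))
    ... | inj₂ qe∈B = x∈p∪q⁺ (inj₂ (∈-preimage⁺ q qe∈B))

smallCover-swap : {p q : Fin n → Fin m} {T : Subset n} → SmallCover p q T → SmallCover q p T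
smallCover-swap {m = m} (A , B , cov , <m) =
  B , A , (λ e e∈T → Sum.swap (cov e e∈T)) , subst (_< m) (ℕ.+-comm ∣ A ∣ ∣ B ∣) <m

-- Pruning all edges leaves a set `T` that still has no small cover, hence hits both partitions, and
-- that has at most one point in each block of `p`: a perfect matching.
common-transversal : .{{_ : NonZero r}} {p q : Fin n → Fin m} → Equitable r p → Equitable r q →
  ∃ λ S → Hits p S × Hits q S × ∣ S ∣ ℕ.≤ m
common-transversal {r = r} {m = m} {p = p} {q = q} eqp eqq
  with T , ¬small , inj ← prune p q ⊤ (<-wellFounded _) (equitable⇒¬smallCover p q {r} eqp eqq)
  = S , hits-mono T⊆S hitsp , hits-mono T⊆S hitsq
      , subst (∣ S ∣ ℕ.≤_) (∣⊤∣≡n m) (∣image∣≤ rep ⊤)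
  where
  hitsp : Hits p T
  hitsp = ¬smallCover⇒hitsˡ p q ¬small

  hitsq : Hits q T
  hitsq = ¬smallCover⇒hitsˡ q p (¬small ∘ smallCover-swap)

  rep : Fin _ → Fin _
  rep = proj₁ ∘ hitsp

  -- This is `T` again, presented as the image of the `m` block indices so that its size is at most
  -- `m`. Injectivity of `p` on `T` makes the representative of the block of `e` equal to `e`.
  S : Subset _
  S = image rep ⊤

  T⊆S : T ⊆ S
  T⊆S {e} e∈T = subst (_∈ S)
    (inj (proj₁ (proj₂ (hitsp (p e)))) e∈T (proj₂ (proj₂ (hitsp (p e)))))
    (∈-image⁺ rep ∈⊤)

-- Enlarging a set to meet one more partition.

equitable⇒hits-⊤ : .{{_ : NonZero r}} {p : Fin n → Fin m} → Equitable r p → Hits p ⊤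
equitable⇒hits-⊤ {r = r} {p = p} eqp =
  -- Both sides of the multigraph are taken to be `p`, so the covering argument also shows that no
  -- block is empty.
  ¬smallCover⇒hitsˡ p p (equitable⇒¬smallCover p p {r} eqp eqp)

-- One representative of each missed block is added. The inequality is
-- `r (∣ S′ ∣ - ∣ S ∣) ≤ n - ∣ S ∣` without subtraction; it holds because the missed blocks, of `r`
-- points each, are disjoint from `S`.
extend-to-hit : .{{_ : NonZero r}} {p : Fin n → Fin m} → Equitable r p → ∀ S →
  ∃ λ S′ → S ⊆ S′ × Hits p S′ × r ℕ.* ∣ S′ ∣ ℕ.+ ∣ S ∣ ℕ.≤ r ℕ.* ∣ S ∣ ℕ.+ n
extend-to-hit {r} {n} {m} {p} eqp S = S ∪ R , x∈p∪q⁺ ∘ inj₁ , hits , size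
  where
  open ℕ.≤-Reasoning

  hits-⊤ : Hits p ⊤
  hits-⊤ = equitable⇒hits-⊤ {r = r} {p = p} eqp

  missed : Subset m
  missed = ∁ (image p S)

  rep : Fin m → Fin n
  rep = proj₁ ∘ hits-⊤

  p-rep : ∀ i → p (rep i) ≡ i
  p-rep i = proj₂ (proj₂ (hits-⊤ i))

  R : Subset n
  R = image rep missed

  hits : Hits p (S ∪ R)
  hits i with i ∈? image p S
  ... | yes i∈ = let e , e∈S , pe≡i = ∈-image⁻ p S i∈ in e , x∈p∪q⁺ (inj₁ e∈S) , pe≡i
  ... | no i∉  = rep i , x∈p∪q⁺ (inj₂ (∈-image⁺ rep (x∉p⇒x∈∁p i∉))) , p-rep i

  preimage⊆ : preimage p missed ⊆ ∁ S
  preimage⊆ e∈ = x∉p⇒x∈∁p (λ e∈S → x∈∁p⇒x∉p (∈-preimage⁻ p e∈) (∈-image⁺ p e∈S))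

  size : r ℕ.* ∣ S ∪ R ∣ ℕ.+ ∣ S ∣ ℕ.≤ r ℕ.* ∣ S ∣ ℕ.+ n
  size = begin
    r ℕ.* ∣ S ∪ R ∣ ℕ.+ ∣ S ∣
      ≤⟨ ℕ.+-monoˡ-≤ ∣ S ∣ (ℕ.*-monoʳ-≤ r (∣p∪q∣≤∣p∣+∣q∣ S R)) ⟩
    r ℕ.* (∣ S ∣ ℕ.+ ∣ R ∣) ℕ.+ ∣ S ∣
      ≤⟨ ℕ.+-monoˡ-≤ ∣ S ∣ (ℕ.*-monoʳ-≤ r (ℕ.+-monoʳ-≤ ∣ S ∣ (∣image∣≤ rep missed))) ⟩
    r ℕ.* (∣ S ∣ ℕ.+ ∣ missed ∣) ℕ.+ ∣ S ∣
      ≡⟨ cong (ℕ._+ ∣ S ∣) (ℕ.*-distribˡ-+ r ∣ S ∣ ∣ missed ∣) ⟩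
    (r ℕ.* ∣ S ∣ ℕ.+ r ℕ.* ∣ missed ∣) ℕ.+ ∣ S ∣
      ≡⟨ ℕ.+-assoc (r ℕ.* ∣ S ∣) _ _ ⟩
    r ℕ.* ∣ S ∣ ℕ.+ (r ℕ.* ∣ missed ∣ ℕ.+ ∣ S ∣)
      ≡⟨ cong (λ k → r ℕ.* ∣ S ∣ ℕ.+ (k ℕ.+ ∣ S ∣)) (eqp missed) ⟨
    r ℕ.* ∣ S ∣ ℕ.+ (∣ preimage p missed ∣ ℕ.+ ∣ S ∣)
      ≤⟨ ℕ.+-monoʳ-≤ (r ℕ.* ∣ S ∣) (ℕ.+-monoˡ-≤ ∣ S ∣ (p⊆q⇒∣p∣≤∣q∣ preimage⊆)) ⟩
    r ℕ.* ∣ S ∣ ℕ.+ (∣ ∁ S ∣ ℕ.+ ∣ S ∣)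
      ≡⟨ cong (r ℕ.* ∣ S ∣ ℕ.+_) (∣∁p∣+∣p∣≡n S) ⟩
    r ℕ.* ∣ S ∣ ℕ.+ n ∎

-- Meeting all partitions, by induction on their number.

module _ .{{_ : NonZero r}} where

  private
    s = ℕ.pred r

  -- The bound ∣ S ∣ ≤ (1 - (s / r) ^ (j + 1)) n with denominators cleared and no subtraction.
  simultaneously-hit : ∀ j (p : Fin (2 ℕ.+ j) → Fin n → Fin m) → (∀ i → Equitable r (p i)) →
    ∃ λ S → (∀ i → Hits (p i) S) ×
      r ℕ.^ ℕ.suc j ℕ.* ∣ S ∣ ℕ.+ s ℕ.^ ℕ.suc j ℕ.* n ℕ.≤ r ℕ.^ ℕ.suc j ℕ.* n
  -- For two partitions a common transversal has at most `m` points, and `r m ≤ n`.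
  simultaneously-hit {n} {m} ℕ.zero p eq
    with S , hits₀ , hits₁ , ∣S∣≤m ← common-transversal {r = r} (eq zero) (eq (suc zero))
    = S , (λ { zero → hits₀ ; (suc zero) → hits₁ }) , (begin
      r ℕ.^ 1 ℕ.* ∣ S ∣ ℕ.+ s ℕ.^ 1 ℕ.* n
        ≡⟨ cong₂ (λ a b → a ℕ.* ∣ S ∣ ℕ.+ b ℕ.* n) (ℕ.*-identityʳ r) (ℕ.*-identityʳ s) ⟩
      r ℕ.* ∣ S ∣ ℕ.+ s ℕ.* n  ≤⟨ ℕ.+-monoˡ-≤ (s ℕ.* n) (ℕ.*-monoʳ-≤ r ∣S∣≤m) ⟩
      r ℕ.* m ℕ.+ s ℕ.* n      ≤⟨ ℕ.+-monoˡ-≤ (s ℕ.* n) (r*m≤n {r = r} {p zero} (eq zero)) ⟩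
      n ℕ.+ s ℕ.* n            ≡⟨ cong (ℕ._* n) (ℕ.suc-pred r) ⟩
      r ℕ.* n                  ≡⟨ cong (ℕ._* n) (ℕ.*-identityʳ r) ⟨
      r ℕ.^ 1 ℕ.* n            ∎)
    where open ℕ.≤-Reasoning
  -- The induction hypothesis meets all partitions but `p zero`, for which the set is then enlarged.
  simultaneously-hit {n} (ℕ.suc j) p eq
    with S , hits , bound ← simultaneously-hit j (p ∘ suc) (eq ∘ suc)
    with S′ , S⊆S′ , hits₀ , step ← extend-to-hit {r = r} (eq zero) S
    = S′ , (λ { zero → hits₀ ; (suc i) → hits-mono S⊆S′ (hits i) })
         -- Adding `P * x` to both sides lets `step` be scaled by `P`. Expanding `r` as `suc s` then
         -- isolates `s` times the left side of `bound`.
         , ℕ.+-cancelʳ-≤ (P ℕ.* x) _ _ (begin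
      r ℕ.* P ℕ.* y ℕ.+ s ℕ.* Q ℕ.* n ℕ.+ P ℕ.* x
        ≡⟨ solve 7 (λ r P y s Q n x → r :* P :* y :+ s :* Q :* n :+ P :* x
                      := P :* (r :* y :+ x) :+ s :* (Q :* n)) refl r P y s Q n x ⟩
      P ℕ.* (r ℕ.* y ℕ.+ x) ℕ.+ s ℕ.* (Q ℕ.* n)
        ≤⟨ ℕ.+-monoˡ-≤ _ (ℕ.*-monoʳ-≤ P step) ⟩
      P ℕ.* (r ℕ.* x ℕ.+ n) ℕ.+ s ℕ.* (Q ℕ.* n)
        ≡⟨ cong (λ r → P ℕ.* (r ℕ.* x ℕ.+ n) ℕ.+ s ℕ.* (Q ℕ.* n)) (ℕ.suc-pred r) ⟨
      P ℕ.* (ℕ.suc s ℕ.* x ℕ.+ n) ℕ.+ s ℕ.* (Q ℕ.* n)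
        ≡⟨ solve 5 (λ P s x n Q → P :* ((con 1 :+ s) :* x :+ n) :+ s :* (Q :* n)
                      := s :* (P :* x :+ Q :* n) :+ (P :* n :+ P :* x)) refl P s x n Q ⟩
      s ℕ.* (P ℕ.* x ℕ.+ Q ℕ.* n) ℕ.+ (P ℕ.* n ℕ.+ P ℕ.* x)
        ≤⟨ ℕ.+-monoˡ-≤ _ (ℕ.*-monoʳ-≤ s bound) ⟩
      s ℕ.* (P ℕ.* n) ℕ.+ (P ℕ.* n ℕ.+ P ℕ.* x)
        ≡⟨ solve 4 (λ s P n x → s :* (P :* n) :+ (P :* n :+ P :* x)
                      := (con 1 :+ s) :* P :* n :+ P :* x) refl s P n x ⟩
      ℕ.suc s ℕ.* P ℕ.* n ℕ.+ P ℕ.* x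
        ≡⟨ cong (λ r → r ℕ.* P ℕ.* n ℕ.+ P ℕ.* x) (ℕ.suc-pred r) ⟩
      r ℕ.* P ℕ.* n ℕ.+ P ℕ.* x ∎)
    where
    open ℕ.≤-Reasoning
    open ℕ.+-*-Solver
    P = r ℕ.^ ℕ.suc j
    Q = s ℕ.^ ℕ.suc j
    x = ∣ S ∣
    y = ∣ S′ ∣

-- Disjoint copies of a clique as an equitable partition.

indicator : Bool → ℕ
indicator b = if b then 1 else 0

∣tabulate∣ : (f : Fin n → _) → ∣ tabulate f ∣ ≡ sum (indicator ∘ f)
∣tabulate∣ {ℕ.zero}  f = refl
∣tabulate∣ {ℕ.suc n} f with f zero
... | true  = cong ℕ.suc (∣tabulate∣ (f ∘ suc))
... | false = ∣tabulate∣ (f ∘ suc)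

sum-↑ : ∀ m {n} (f : Fin (m ℕ.+ n) → ℕ) → sum f ≡ sum (f ∘ (_↑ˡ n)) ℕ.+ sum (f ∘ (m ↑ʳ_))
sum-↑ ℕ.zero    f = refl
sum-↑ (ℕ.suc m) f = trans (cong (f zero ℕ.+_) (sum-↑ m (f ∘ suc))) (sym (ℕ.+-assoc (f zero) _ _))

sum-const : ∀ n c → sum {n} (λ _ → c) ≡ n ℕ.* c
sum-const ℕ.zero    c = refl
sum-const (ℕ.suc n) c = cong (c ℕ.+_) (sum-const n c)

-- The quotient is constant on consecutive runs of length `r`: the first run contributes
-- `r * f zero`, and the rest follows by induction on `m`.
sum-quotient : ∀ m r (f : Fin m → ℕ) → sum (f ∘ quotient {m} r) ≡ r ℕ.* sum f
sum-quotient ℕ.zero    r f = sym (ℕ.*-zeroʳ r)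
sum-quotient (ℕ.suc m) r f = begin
  sum (f ∘ quotient {ℕ.suc m} r)
    ≡⟨ sum-↑ r _ ⟩
  sum (f ∘ quotient {ℕ.suc m} r ∘ (_↑ˡ (m ℕ.* r))) ℕ.+ sum (f ∘ quotient {ℕ.suc m} r ∘ (r ↑ʳ_))
    ≡⟨ cong₂ ℕ._+_ (sum-cong-≗ left) (sum-cong-≗ right) ⟩
  sum {r} (λ _ → f zero) ℕ.+ sum (f ∘ suc ∘ quotient {m} r)
    ≡⟨ cong₂ ℕ._+_ (sum-const r (f zero)) (sum-quotient m r (f ∘ suc)) ⟩
  r ℕ.* f zero ℕ.+ r ℕ.* sum (f ∘ suc)
    ≡⟨ ℕ.*-distribˡ-+ r (f zero) _ ⟨
  r ℕ.* sum f ∎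
  where
  open ≡-Reasoning

  left : ∀ i → f (quotient {ℕ.suc m} r (i ↑ˡ (m ℕ.* r))) ≡ f zero
  left i rewrite splitAt-↑ˡ r i (m ℕ.* r) = refl

  right : ∀ i → f (quotient {ℕ.suc m} r (r ↑ʳ i)) ≡ f (suc (quotient {m} r i))
  right i rewrite splitAt-↑ʳ r (m ℕ.* r) i = refl

module _ {G : Graph (Fin n)} (G≅ : G ≅ copies m (K r)) where

  private
    module f = Bijection (proj₁ G≅)

  block : Fin n → Fin m
  block = proj₁ ∘ f.to

  -- Numbering the pairs (copy, vertex) turns the isomorphism into a bijection of `Fin n` with
  -- `Fin (m * r)` that carries `block` to `quotient`. Sums of indicators are invariant under it.
  block-equitable : Equitable r block
  block-equitable A = begin
    ∣ preimage block A ∣                                 ≡⟨ ∣tabulate∣ (lookup A ∘ block) ⟩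
    sum (a ∘ block)                                      ≡⟨ sum-cong-≗ (λ e → cong a (block≡ e)) ⟩
    sum (a ∘ quotient {m} r ∘ (π ⟨$⟩ʳ_))                 ≡⟨ sum-permute (a ∘ quotient {m} r) π ⟨
    sum (a ∘ quotient {m} r)                             ≡⟨ sum-quotient m r a ⟩
    r ℕ.* sum a                                          ≡⟨ cong (r ℕ.*_) (∣tabulate∣ (lookup A)) ⟨
    r ℕ.* ∣ tabulate (lookup A) ∣                        ≡⟨ cong (λ A → r ℕ.* ∣ A ∣) (tabulate∘lookup A) ⟩
    r ℕ.* ∣ A ∣                                          ∎
    where
    open ≡-Reasoning

    a : Fin m → ℕ
    a = indicator ∘ lookup A

    π : Permutation n (m ℕ.* r)
    π = ↔-sym *↔× ↔-∘ ⤖⇒↔ (proj₁ G≅)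

    block≡ : ∀ e → block e ≡ quotient {m} r (π ⟨$⟩ʳ e)
    block≡ e = sym (cong proj₁ (remQuot-combine {m} (proj₁ (f.to e)) (proj₂ (f.to e))))

  -- Distinct vertices of one clique are adjacent, so a point of `S` in the block of `v` is a
  -- neighbour of `v` unless it is `v` itself, which `v ∉ S` excludes.
  hits⇒dominates : ∀ {S} → Hits block S → ∀ v → v ∉ S → ∃ λ u → u ∈ S × Adj G v u
  hits⇒dominates {S} hits v v∉S
    with u , u∈S , same ← hits (block v)
    = u , u∈S , Equivalence.from (proj₂ G≅ v u) (sym same , λ eq₂ →
        v∉S (subst (_∈ S) (sym (f.injective (cong₂ _,_ (sym same) eq₂))) u∈S))

γsd≤ : ∀ {k} (F : Fin k → Graph (Fin n)) {S} → SimultaneousDominating F S → γsd F ℕ.≤ ∣ S ∣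
γsd≤ F {S} dom = proj₂ (proj₂ (minimumSize F)) ∣ S ∣ (S , dom , refl)

-- From inequalities of natural numbers to rational ones.

fromℚᵘ-homo-* : ∀ p q → fromℚᵘ (p ℚᵘ.* q) ≡ fromℚᵘ p * fromℚᵘ q
fromℚᵘ-homo-* p q = ℚ.toℚᵘ-injective (begin
  toℚᵘ (fromℚᵘ (p ℚᵘ.* q))                ≈⟨ ℚ.toℚᵘ-fromℚᵘ (p ℚᵘ.* q) ⟩
  p ℚᵘ.* q                                ≈⟨ ℚᵘ.*-cong (ℚ.toℚᵘ-fromℚᵘ p) (ℚ.toℚᵘ-fromℚᵘ q) ⟨
  toℚᵘ (fromℚᵘ p) ℚᵘ.* toℚᵘ (fromℚᵘ q)    ≈⟨ ℚ.toℚᵘ-homo-* (fromℚᵘ p) (fromℚᵘ q) ⟨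
  toℚᵘ (fromℚᵘ p * fromℚᵘ q)              ∎)
  where open import Relation.Binary.Reasoning.Setoid ℚᵘ.≃-setoid

fromℚᵘ-homo-+ : ∀ p q → fromℚᵘ (p ℚᵘ.+ q) ≡ fromℚᵘ p ℚ.+ fromℚᵘ q
fromℚᵘ-homo-+ p q = ℚ.toℚᵘ-injective (begin
  toℚᵘ (fromℚᵘ (p ℚᵘ.+ q))                ≈⟨ ℚ.toℚᵘ-fromℚᵘ (p ℚᵘ.+ q) ⟩
  p ℚᵘ.+ q                                ≈⟨ ℚᵘ.+-cong (ℚ.toℚᵘ-fromℚᵘ p) (ℚ.toℚᵘ-fromℚᵘ q) ⟨
  toℚᵘ (fromℚᵘ p) ℚᵘ.+ toℚᵘ (fromℚᵘ q)    ≈⟨ ℚ.toℚᵘ-homo-+ (fromℚᵘ p) (fromℚᵘ q) ⟨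
  toℚᵘ (fromℚᵘ p ℚ.+ fromℚᵘ q)            ∎)
  where open import Relation.Binary.Reasoning.Setoid ℚᵘ.≃-setoid

fromℕ : ℕ → ℚ
fromℕ n = (+ n) / 1

-- Between unnormalised fractions with denominator 1 this is an identity of integers, which `fromℚᵘ`
-- carries to normalised ones.
fromℕ-homo-* : ∀ a b → fromℕ (a ℕ.* b) ≡ fromℕ a * fromℕ b
fromℕ-homo-* a b = trans
  (ℚ.fromℚᵘ-cong {mkℚᵘ (+ (a ℕ.* b)) 0} {mkℚᵘ (+ a) 0 ℚᵘ.* mkℚᵘ (+ b) 0}
    (*≡* (cong (ℤ._* + 1) (ℤ.pos-* a b))))
  (fromℚᵘ-homo-* (mkℚᵘ (+ a) 0) (mkℚᵘ (+ b) 0))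

fromℕ-homo-+ : ∀ a b → fromℕ (a ℕ.+ b) ≡ fromℕ a ℚ.+ fromℕ b
fromℕ-homo-+ a b = trans
  (ℚ.fromℚᵘ-cong {mkℚᵘ (+ (a ℕ.+ b)) 0} {mkℚᵘ (+ a) 0 ℚᵘ.+ mkℚᵘ (+ b) 0}
    (*≡* (cong (ℤ._* + 1) (sym (cong₂ ℤ._+_ (ℤ.*-identityʳ (+ a)) (ℤ.*-identityʳ (+ b)))))))
  (fromℚᵘ-homo-+ (mkℚᵘ (+ a) 0) (mkℚᵘ (+ b) 0))

fromℕ-mono-≤ : ∀ {a b} → a ℕ.≤ b → fromℕ a ≤ fromℕ b
fromℕ-mono-≤ {a} {b} a≤b = ℚ.toℚᵘ-cancel-≤ (begin
  toℚᵘ (fromℕ a)  ≃⟨ ℚ.toℚᵘ-fromℚᵘ (mkℚᵘ (+ a) 0) ⟩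
  mkℚᵘ (+ a) 0    ≤⟨ ℚᵘ.*≤* (ℤ.*-monoʳ-≤-nonNeg (+ 1) (ℤ.+≤+ a≤b)) ⟩
  mkℚᵘ (+ b) 0    ≃⟨ ℚ.toℚᵘ-fromℚᵘ (mkℚᵘ (+ b) 0) ⟨
  toℚᵘ (fromℕ b)  ∎)
  where open ℚᵘ.≤-Reasoning

fromℕ-pos : ∀ a .{{_ : NonZero a}} → ℚ.Positive (fromℕ a)
fromℕ-pos a = ℚ.normalize-pos a 1

fromℕ-cancel-/ : ∀ r .{{_ : NonZero r}} a → fromℕ r * ((+ a) / r) ≡ fromℕ a
fromℕ-cancel-/ r@(ℕ.suc s) a = trans
  (sym (fromℚᵘ-homo-* (mkℚᵘ (+ r) 0) (mkℚᵘ (+ a) s)))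
  (ℚ.fromℚᵘ-cong {mkℚᵘ (+ r) 0 ℚᵘ.* mkℚᵘ (+ a) s} {mkℚᵘ (+ a) 0} (*≡* (begin
    + r ℤ.* + a ℤ.* + 1    ≡⟨ ℤ.*-identityʳ _ ⟩
    + r ℤ.* + a            ≡⟨ ℤ.*-comm (+ r) (+ a) ⟩
    + a ℤ.* + r            ≡⟨ cong (λ k → + a ℤ.* + k) (ℕ.*-identityˡ r) ⟨
    + a ℤ.* + (1 ℕ.* r)    ∎)))
  where open ≡-Reasoning

fromℕ-cancel-/^ : ∀ r .{{_ : NonZero r}} a k → fromℕ (r ℕ.^ k) * ((+ a) / r) ^ k ≡ fromℕ (a ℕ.^ k)
fromℕ-cancel-/^ r a ℕ.zero    = refl
fromℕ-cancel-/^ r a (ℕ.suc k) = begin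
  fromℕ (r ℕ.* r ℕ.^ k) * (x * x ^ k)          ≡⟨ cong (_* (x * x ^ k)) (fromℕ-homo-* r (r ℕ.^ k)) ⟩
  fromℕ r * fromℕ (r ℕ.^ k) * (x * x ^ k)      ≡⟨ interchange (fromℕ r) (fromℕ (r ℕ.^ k)) x (x ^ k) ⟩
  (fromℕ r * x) * (fromℕ (r ℕ.^ k) * x ^ k)    ≡⟨ cong₂ _*_ (fromℕ-cancel-/ r a) (fromℕ-cancel-/^ r a k) ⟩
  fromℕ a * fromℕ (a ℕ.^ k)                    ≡⟨ fromℕ-homo-* a (a ℕ.^ k) ⟨
  fromℕ (a ℕ.* a ℕ.^ k)                        ∎
  where
  open ≡-Reasoning
  open import Algebra.Properties.CommutativeSemigroup
    (CommutativeRing.*-commutativeSemigroup ℚ.+-*-commutativeRing) using (interchange)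
  x : ℚ
  x = (+ a) / r

-- Multiplying by the positive number `r ^ k` clears the denominator of the power; subtracting
-- `a ^ k * n` from both sides of `h` then gives the claim.
bound-in-ℚ : ∀ r .{{_ : NonZero r}} a k g n →
  r ℕ.^ k ℕ.* g ℕ.+ a ℕ.^ k ℕ.* n ℕ.≤ r ℕ.^ k ℕ.* n →
  fromℕ g ≤ (1ℚ - ((+ a) / r) ^ k) * fromℕ n
bound-in-ℚ r a k g n h = ℚ.*-cancelˡ-≤-pos R {{fromℕ-pos (r ℕ.^ k) {{ℕ.m^n≢0 r k}}}} (begin
  R * G                                   ≡⟨ solve 2 (λ u t → u := u :+ t :- t) refl (R * G) (A * N) ⟩
  R * G ℚ.+ A * N - A * N                 ≤⟨ ℚ.+-monoˡ-≤ (ℚ.- (A * N)) scaled ⟩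
  R * N - A * N                           ≡⟨ cong (λ A → R * N - A * N) (fromℕ-cancel-/^ r a k) ⟨
  R * N - R * y * N                       ≡⟨ solve 3 (λ R y N → R :* N :- R :* y :* N
                                                := R :* ((con 1ℚ :- y) :* N)) refl R y N ⟩
  R * ((1ℚ - y) * N)                      ∎)
  where
  open ℚ.≤-Reasoning
  open ℚ.+-*-Solver
  R = fromℕ (r ℕ.^ k)
  A = fromℕ (a ℕ.^ k)
  G = fromℕ g
  N = fromℕ n
  y = ((+ a) / r) ^ k

  scaled : R * G ℚ.+ A * N ≤ R * N
  scaled = begin
    R * G ℚ.+ A * N                                   ≡⟨ cong₂ ℚ._+_ (fromℕ-homo-* (r ℕ.^ k) g) (fromℕ-homo-* (a ℕ.^ k) n) ⟨
    fromℕ (r ℕ.^ k ℕ.* g) ℚ.+ fromℕ (a ℕ.^ k ℕ.* n)   ≡⟨ fromℕ-homo-+ (r ℕ.^ k ℕ.* g) _ ⟨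
    fromℕ (r ℕ.^ k ℕ.* g ℕ.+ a ℕ.^ k ℕ.* n)           ≤⟨ fromℕ-mono-≤ h ⟩
    fromℕ (r ℕ.^ k ℕ.* n)                             ≡⟨ fromℕ-homo-* (r ℕ.^ k) n ⟩
    R * N                                             ∎

theorem18 : (r n k : ℕ) .{{_ : NonZero r}} → r ℕ.≤ n → n ℕ.% r ≡ 0 → 2 ℕ.≤ k →
    (F : Fin k → Graph (Fin n)) →
    (∀ i → F i ≅ copies (n ℕ./ r) (K r)) →
    (+ γsd F) / 1 ≤ (1ℚ - ((+ r ℤ.- + 1) / r) ^ (k ℕ.∸ 1)) * ((+ n) / 1)
theorem18 _ _ 1 _ _ (s≤s ())
-- Writing `r` as `suc s` makes both `+ r ℤ.- + 1` and `ℕ.pred r` reduce to `s`. With `k` equal to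
-- `j + 2`, the exponent `k ∸ 1` becomes `suc j`.
theorem18 r@(ℕ.suc s) n (ℕ.suc (ℕ.suc j)) _ _ _ F F≅ =
  bound-in-ℚ r s (ℕ.suc j) (γsd F) n (ℕ.≤-trans
    (ℕ.+-monoˡ-≤ _ (ℕ.*-monoʳ-≤ (r ℕ.^ ℕ.suc j) (γsd≤ F dominating)))
    (proj₂ (proj₂ solution)))
  where
  blocks : Fin (2 ℕ.+ j) → Fin n → Fin (n ℕ./ r)
  blocks i = block {G = F i} (F≅ i)

  solution = simultaneously-hit {r = r} j blocks (λ i → block-equitable {G = F i} (F≅ i))

  dominating : SimultaneousDominating F (proj₁ solution)
  dominating i = hits⇒dominates {G = F i} (F≅ i) (proj₁ (proj₂ solution) i)
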